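{- $|I_k(123)|$ enumerates indecomposable subdiagonal sequences (with sum of entries $k$) where non-diagonal elements are in (strictly) decreasing order. Let \[c_{n,m,k} = \begin{cases} 0 & \text{if } n<0 \text{ or } k<0,\\ 1 & \text{if } n=k=0,\\ c_{n-1,m,k-n+1}+\sum_{i=0}^{\min(n-2,m-1)} c_{n-1,i,k-i} & \text{otherwise.}\end{cases}\] Then the total number of permutations with $k$ inversions (including decomposable ones) avoiding $123$ can be calculated as $\sum_{n=0}^{k+1} c_{n,n,k}$. To obtain the number of such permutations that are indecomposable, subtract the $k$-th coefficient (the coefficient of $x^k$) of $\left(\sum_{i\ge 0} x^{i(i+1)/2}\right)^2$.
   Context: A permutation of length $n$ is a word $\pi=\pi_1\cdots\pi_n$ containing each of $1,\dots,n$ exactly once. The sum of permutations $\rho=\rho_1\cdots\rho_n$ and $\tau=\tau_1\cdots\tau_m$ is the permutation $\rho\oplus\tau=\rho_1\cdots\rho_n(n+\tau_1)\cdots(n+\tau_m)$ of length $n+m$. A permutation is decomposable if it equals $\rho\oplus\tau$ for some non-empty permutations $\rho,\tau$; a permutation that is not decomposable is indecomposable. An inversion of $\pi$ is a pair of indices $(i,j)$ with $i<j$ and $\pi_i>\pi_j$. A permutation $\pi$ contains a pattern (permutation) $\tau=\tau_1\cdots\tau_m$ if there are indices $i_1<\dots<i_m$ such that $\pi_{i_1}\cdots\pi_{i_m}$ is order-isomorphic to $\tau_1\cdots\tau_m$; otherwise $\pi$ avoids $\tau$. $I_k(\tau)$ denotes the (finite) set of all indecomposable permutations, of any length, with exactly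 $k$ inversions that avoid $\tau$. A sequence of $n$ non-negative integers is subdiagonal if its first value is $\le n-1$, the next $\le n-2$, and so on, i.e. its $i$-th value is $\le n-i$. Elements of a subdiagonal sequence that are equal to their maximum possible value (the $i$-th value being equal to $n-i$) are called diagonal elements; the others are non-diagonal. The sum of two subdiagonal sequences $\rho_1,\dots,\rho_p$ and $\tau_1,\dots,\tau_\ell$ is the sequence $\rho_1,\dots,\rho_p,\tau_1+p,\dots,\tau_\ell+p$. A subdiagonal sequence is indecomposable if it cannot be written as the sum of two non-empty subdiagonal sequences. A sum whose upper limit is less than its lower limit is empty.
   Formalization: The sum of subdiagonal sequences is plain concatenation (the shift by p never gives a subdiagonal sequence), and the upper limit is k+2 for all k, with the printed k+1 proved for k≥3 (for k=1 the printed sum is 1, but 21, 132, 213 are 3 permutations). -}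

module Defs where

open import Data.Fin.Base as Fin using (Fin; toℕ)
import Data.Fin.Properties as Fin
open import Data.Integer.Base as ℤ using (ℤ; +_; -[1+_])
open import Data.List.Base
  using (List; []; _∷_; _++_; map; length; lookup; upTo; applyUpTo; allFin; cartesianProduct; filter)
open import Data.List.Membership.Propositional using (_∈_)
open import Data.List.Relation.Binary.Permutation.Propositional using (_↭_)
open import Data.List.Relation.Unary.Unique.Propositional using (Unique)
open import Data.Nat.Base using (ℕ; zero; suc; _+_; _*_; _∸_; _/_; _≤_; _<_)
open import Data.Nat.ListAction using (sum)
open import Data.Nat.Properties using (_≟_; _<?_)
open import Data.Product.Base using (∃-syntax; Σ-syntax; _×_; _,_)
open import Function.Bundles using (_⇔_)
open import Relation.Binary.PropositionalEquality using (_≡_; _≢_)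
open import Relation.Nullary.Decidable using (_×-dec_)
open import Relation.Nullary.Negation using (¬_)

-- The set { x | P x } is finite with exactly N elements.
HasCardinality : {A : Set} → (A → Set) → ℕ → Set
HasCardinality {A} P N =
  ∃[ xs ] (Unique xs × (∀ (x : A) → x ∈ xs ⇔ P x) × length xs ≡ N)

------------------------------------------------------------------------
-- Permutations, as words over {1, …, n}.  The empty word is the
-- permutation of length 0.

IsPermutation : List ℕ → Set
IsPermutation π = π ↭ applyUpTo suc (length π)

infixr 6 _⊕_
_⊕_ : List ℕ → List ℕ → List ℕ
ρ ⊕ τ = ρ ++ map (λ t → length ρ + t) τ

Decomposable : List ℕ → Set
Decomposable π =
  ∃[ ρ ] ∃[ τ ] (IsPermutation ρ × IsPermutation τ × ρ ≢ [] × τ ≢ [] × π ≡ ρ ⊕ τ)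

Indecomposable : List ℕ → Set
Indecomposable π = ¬ Decomposable π

inversions : List ℕ → ℕ
inversions π =
  length (filter (λ (i , j) → (i Fin.<? j) ×-dec (lookup π j <? lookup π i))
                 (cartesianProduct (allFin (length π)) (allFin (length π))))

Contains : List ℕ → List ℕ → Set
Contains π τ =
  Σ[ f ∈ (Fin (length τ) → Fin (length π)) ]
    ((∀ (a b : Fin (length τ)) → a Fin.< b → f a Fin.< f b) ×
     (∀ (a b : Fin (length τ)) →
        lookup τ a < lookup τ b ⇔ lookup π (f a) < lookup π (f b)))

Avoids : List ℕ → List ℕ → Set
Avoids π τ = ¬ Contains π τ

-- All permutations, of any length, with k inversions that avoid τ.
AvoidersWithInversions : ℕ → List ℕ → List ℕ → Set
AvoidersWithInversions k τ π = IsPermutation π × inversions π ≡ k × Avoids π τ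

I : ℕ → List ℕ → List ℕ → Set
I k τ π = AvoidersWithInversions k τ π × Indecomposable π

p123 : List ℕ
p123 = 1 ∷ 2 ∷ 3 ∷ []

------------------------------------------------------------------------
-- Subdiagonal sequences

-- The bound n − i on the i-th value of a sequence of length n, where
-- i = suc (toℕ j) because positions in a list are counted from 0.
maxAt : (s : List ℕ) → Fin (length s) → ℕ
maxAt s j = length s ∸ suc (toℕ j)

Subdiagonal : List ℕ → Set
Subdiagonal s = ∀ j → lookup s j ≤ maxAt s j

Diagonal : (s : List ℕ) → Fin (length s) → Set
Diagonal s j = lookup s j ≡ maxAt s j

NonDiagonalDecreasing : List ℕ → Set
NonDiagonalDecreasing s =
  ∀ i j → i Fin.< j → ¬ Diagonal s i → ¬ Diagonal s j → lookup s j < lookup s i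

-- The sum of two subdiagonal sequences is their concatenation, without
-- a shift of the second summand: with entry i bounded by n − i, shifting
-- by p > 0 would make the last entry exceed its bound 0.  Concatenation
-- is what ⊕ becomes under π ↦ (#{ j > i | π_j < π_i })_i.
DecomposableSeq : List ℕ → Set
DecomposableSeq s =
  ∃[ ρ ] ∃[ τ ] (Subdiagonal ρ × Subdiagonal τ × ρ ≢ [] × τ ≢ [] × s ≡ ρ ++ τ)

IndecomposableSeq : List ℕ → Set
IndecomposableSeq s = ¬ DecomposableSeq s

SubdiagonalSequences : ℕ → List ℕ → Set
SubdiagonalSequences k s =
  Subdiagonal s × IndecomposableSeq s × sum s ≡ k × NonDiagonalDecreasing s

------------------------------------------------------------------------
-- The numbers c_{n,m,k}

-- The indices 0, …, u; none if u is negative.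
from0To : ℤ → List ℕ
from0To (+ u)    = upTo (suc u)
from0To -[1+ _ ] = []

-- For n = 0 < k the general recurrence reads c_{-1,m,k+1} plus an empty
-- sum, which is 0; it is written out so that termination is evident.
c : ℤ → ℤ → ℤ → ℕ
c -[1+ _ ]  m k        = 0
c (+ n)     m -[1+ _ ] = 0
c (+ zero)  m (+ zero) = 1
c (+ zero)  m (+ suc k) = 0
c (+ suc n) m (+ k)    =
  c (+ n) m (+ k ℤ.- + suc n ℤ.+ + 1) +
  sum (map (λ i → c (+ n) (+ i) (+ k ℤ.- + i))
           (from0To ((+ suc n ℤ.- + 2) ℤ.⊓ (m ℤ.- + 1))))

-- Σ_{n=0}^{u} c_{n,n,k}
sumC : ℕ → ℕ → ℕ
sumC u k = sum (map (λ n → c (+ n) (+ n) (+ k)) (upTo (suc u)))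

------------------------------------------------------------------------
-- Formal power series over ℕ, as coefficient functions

PowerSeries : Set
PowerSeries = ℕ → ℕ

infixl 7 _⊛_
_⊛_ : PowerSeries → PowerSeries → PowerSeries
(f ⊛ g) k = sum (map (λ a → f a * g (k ∸ a)) (upTo (suc k)))

-- Σ_{i≥0} x^{i(i+1)/2}: the coefficient of x^j is the number of i with
-- i(i+1)/2 = j, and every such i satisfies i ≤ j.
triangularSeries : PowerSeries
triangularSeries j = length (filter (λ i → i * suc i / 2 ≟ j) (upTo (suc j)))

{-# OPTIONS --safe #-}
module Submission where

-- Replacing each letter of a permutation by the number of smaller letters
-- to its right (its Lehmer code) is a bijection from the permutations of
-- length n to the subdiagonal sequences of length n, by code-injective and
-- code-surjective.  It turns inversions into the sum of the entries
-- (sum-code) and the sum of permutations into concatenation (code-⊕); by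
-- bijectivity, decomposable permutations and decomposable sequences then
-- correspond.
--
-- An entry of the code is diagonal exactly when its letter exceeds all
-- letters to its right.  Hence a permutation avoids 123 iff the letters with
-- a non-diagonal entry decrease, and this holds iff their entries decrease
-- strictly (staggered⇒avoids123 and avoids123⇒staggered).  Only the passage
-- from entries to letters needs thought.  Suppose that w stands to the right
-- of x, that x < w, and that w is smaller than some later letter.  Among
-- the letters to the left of w and smaller than w, the last one starts an
-- ascent, and the smaller letters to its right all come after w and are
-- smaller than w, so its entry is at most that of w.  In noAscentAbove this
-- is an induction on the word to the right of x.
--
-- The sequences obtained are counted by their first entry.  With m an upper
-- bound, exclusive, for the non-diagonal entries, a diagonal first entry
-- leaves m unchanged, and a non-diagonal first entry i < m becomes the new
-- bound; this is the recurrence for c (cardinality-c).  At most two entries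
-- vanish, whence the length is at most k + 2, and at most k + 1 once k ≥ 3.
--
-- In a decomposable sequence of this kind the first summand has no diagonal
-- entry in the whole sequence, so it decreases strictly; being subdiagonal,
-- it is p, p - 1, ..., 0.  After this 0 no non-diagonal entry can follow, so
-- the second summand is q, q - 1, ..., 0 (decomposed).  These sequences
-- correspond to the pairs of triangular numbers with sum k, which the square
-- of the triangular series counts.

open import Defs
open import Data.Fin.Base as Fin using (Fin; zero; suc; toℕ)
import Data.Fin.Properties as Fin
open import Data.Integer.Base as ℤ using (ℤ; +_; -[1+_])
import Data.Integer.Properties as ℤ
open import Data.List.Base
  using (List; []; _∷_; _++_; map; length; lookup; upTo; downFrom; applyUpTo; allFin; filter;
         cartesianProduct)
open import Data.List.Membership.DecPropositional using (_∈?_)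
open import Data.List.Membership.Propositional using (_∈_)
open import Data.List.Membership.Propositional.Properties
  using (∈-map⁺; ∈-map⁻; ∈-++⁺ˡ; ∈-++⁺ʳ; ∈-++⁻; ∈-upTo⁺; ∈-upTo⁻; ∈-filter⁺; ∈-filter⁻;
         ∈-cartesianProduct⁺; ∈-cartesianProduct⁻; ∈-lookup)
open import Data.List.Membership.Propositional.Properties.WithK using (unique∧set⇒bag)
open import Data.List.Properties as List
  using (length-map; length-++; length-applyUpTo; length-downFrom; length-filter;
         filter-all; filter-none; filter-accept; filter-reject; filter-complete;
         filter-++; filter-≐; map-∘; map-cong; map-tabulate; tabulate-lookup; map-applyUpTo;
         ∷-injectiveˡ; ∷-injectiveʳ; ++-cancelˡ)
open import Data.List.Relation.Binary.BagAndSetEquality using (∼bag⇒↭)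
open import Data.List.Relation.Binary.Permutation.Propositional
  using (_↭_; ↭-refl; ↭-sym; ↭-trans; ↭-reflexive; prep; swap; ↭⇒↭ₛ)
open import Data.List.Relation.Binary.Permutation.Propositional.Properties
  using (↭-length; filter-↭; drop-∷; All-resp-↭; ++⁺; map⁺)
import Data.List.Relation.Binary.Permutation.Setoid.Properties as Permutationₛ
open import Data.List.Relation.Unary.All as All using (All; []; _∷_)
import Data.List.Relation.Unary.All.Properties as All
open import Data.List.Relation.Unary.AllPairs as AllPairs using (AllPairs; []; _∷_)
import Data.List.Relation.Unary.AllPairs.Properties as AllPairs
open import Data.List.Relation.Unary.Any using (here; there)
open import Data.List.Relation.Unary.Unique.Propositional using (Unique)
import Data.List.Relation.Unary.Unique.Propositional.Properties as Unique
open import Data.Nat.Base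
open import Data.Nat.DivMod using (m*n/n≡m)
open import Data.Nat.ListAction using (sum)
open import Data.Nat.ListAction.Properties using (sum-++)
open import Data.Nat.Properties
open import Data.Nat.Tactic.RingSolver using (solve-∀)
open import Data.Product.Base using (∃-syntax; Σ-syntax; _×_; _,_; proj₁; proj₂)
open import Data.Sum.Base using (_⊎_; inj₁; inj₂; [_,_]′)
open import Data.Unit.Base using (⊤; tt)
open import Function.Base using (_∘_; id; const)
open import Function.Bundles using (_⇔_; mk⇔; Equivalence)
open import Level using (0ℓ)
open import Relation.Binary.Definitions using (DecidableEquality)
open import Relation.Binary.PropositionalEquality
  using (_≡_; _≢_; refl; sym; trans; cong; cong₂; subst; ≢-sym; setoid; module ≡-Reasoning)
open import Relation.Nullary.Decidable using (yes; no; ¬?; _×-dec_)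
open import Relation.Nullary.Negation using (¬_; contradiction)
open import Relation.Unary using (Pred; Decidable)

open Equivalence using (to; from)

private
  variable
    A B J : Set
    P Q : A → Set
    K M N : ℕ

-- Cardinalities of finite sets

cardinality-resp : (∀ x → P x ⇔ Q x) → HasCardinality P N → HasCardinality Q N
cardinality-resp e (xs , u , h , l) =
  xs , u , (λ x → mk⇔ (to (e x) ∘ to (h x)) (from (h x) ∘ from (e x))) , l

cardinality-unique : HasCardinality P M → HasCardinality P N → M ≡ N
cardinality-unique (xs , u , h , refl) (ys , v , g , refl) =
  ↭-length (∼bag⇒↭ (unique∧set⇒bag u v
    (λ {x} → mk⇔ (from (g x) ∘ to (h x)) (from (h x) ∘ to (g x)))))

cardinality-empty : (∀ x → ¬ P x) → HasCardinality P 0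
cardinality-empty ¬p = [] , [] , (λ x → mk⇔ (λ ()) (λ p → contradiction p (¬p x))) , refl

cardinality-singleton : (a : A) → HasCardinality (_≡ a) 1
cardinality-singleton a =
  a ∷ [] , [] ∷ [] , (λ x → mk⇔ (λ { (here e) → e ; (there ()) }) here) , refl

cardinality-⊎ : (∀ x → P x → ¬ Q x) → HasCardinality P M → HasCardinality Q N →
                HasCardinality (λ x → P x ⊎ Q x) (M + N)
cardinality-⊎ disjoint (xs , u , h , refl) (ys , v , g , refl) =
  xs ++ ys
  , Unique.++⁺ u v (λ (x∈xs , x∈ys) → disjoint _ (to (h _) x∈xs) (to (g _) x∈ys))
  , (λ x → mk⇔ (λ x∈ → [ inj₁ ∘ to (h x) , inj₂ ∘ to (g x) ]′ (∈-++⁻ xs x∈))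
               [ ∈-++⁺ˡ ∘ from (h x) , ∈-++⁺ʳ xs ∘ from (g x) ]′)
  , length-++ xs

-- The union of the pairwise disjoint sets R j with j in js.
cardinality-Σ : {R : J → A → Set} {f : J → ℕ} {js : List J} → Unique js →
                (∀ i j x → R i x → R j x → i ≡ j) →
                (∀ j → HasCardinality (R j) (f j)) →
                HasCardinality (λ x → ∃[ j ] (j ∈ js × R j x)) (sum (map f js))
cardinality-Σ {js = []} [] disjoint h = cardinality-empty λ { x (_ , () , _) }
cardinality-Σ {js = j ∷ js} (j∉js ∷ u) disjoint h =
  cardinality-resp
    (λ x → mk⇔ (λ { (inj₁ r) → j , here refl , r
                  ; (inj₂ (i , i∈ , r)) → i , there i∈ , r })
               (λ { (_ , here refl , r) → inj₁ r
                  ; (i , there i∈ , r) → inj₂ (i , i∈ , r) }))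
    (cardinality-⊎
      (λ { x r (i , i∈ , r′) → All.lookup j∉js i∈ (disjoint j i x r r′) })
      (h j) (cardinality-Σ u disjoint h))

length-cartesianProduct : ∀ (xs : List A) (ys : List B) →
                          length (cartesianProduct xs ys) ≡ length xs * length ys
length-cartesianProduct []       ys = refl
length-cartesianProduct (x ∷ xs) ys = trans (length-++ (map (x ,_) ys))
  (cong₂ _+_ (length-map (x ,_) ys) (length-cartesianProduct xs ys))

cardinality-× : HasCardinality P M → HasCardinality Q N →
                HasCardinality (λ (x , y) → P x × Q y) (M * N)
cardinality-× (xs , u , h , refl) (ys , v , g , refl) =
  cartesianProduct xs ys
  , Unique.cartesianProduct⁺ u v
  , (λ (x , y) → mk⇔
      (λ xy∈ → let (x∈ , y∈) = ∈-cartesianProduct⁻ xs ys xy∈ in to (h x) x∈ , to (g y) y∈)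
      (λ (p , q) → ∈-cartesianProduct⁺ (from (h x) p) (from (g y) q)))
  , length-cartesianProduct xs ys

cardinality-image : {P : A → Set} (f : A → B) → (∀ {x y} → f x ≡ f y → x ≡ y) →
                    HasCardinality P N → HasCardinality (λ y → ∃[ x ] (P x × f x ≡ y)) N
cardinality-image f inj (xs , u , h , refl) =
  map f xs
  , Unique.map⁺ inj u
  , (λ y → mk⇔ (λ y∈ → let (x , x∈ , e) = ∈-map⁻ f y∈ in x , to (h x) x∈ , sym e)
               (λ { (x , p , refl) → ∈-map⁺ f (from (h x) p) }))
  , length-map f xs

-- A map that restricts to a bijection from P to Q transports the
-- cardinality of Q to P.
cardinality-bijection : {P : A → Set} {Q : B → Set} (f : A → B) → (∀ {x} → P x → Q (f x)) →
                        (∀ {x y} → P x → P y → f x ≡ f y → x ≡ y) →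
                        (∀ {y} → Q y → ∃[ x ] (P x × f x ≡ y)) →
                        HasCardinality Q N → HasCardinality P N
cardinality-bijection {A = A} {P = P} {Q = Q} f maps injective surjective (ys , v , g , refl) =
  xs
  , Unique.map⁻ (subst Unique (sym map≡) v)
  , (λ x → mk⇔ (All.lookup all) λ p →
      let (x′ , x′∈ , e) = ∈-map⁻ f (subst (f x ∈_) (sym map≡) (from (g (f x)) (maps p)))
      in subst (_∈ xs) (sym (injective p (All.lookup all x′∈) e)) x′∈)
  , trans (sym (length-map f xs)) (cong length map≡)
  where
  preimages : ∀ {zs} → All Q zs → Σ[ xs ∈ List A ] (All P xs × map f xs ≡ zs)
  preimages [] = [] , [] , refl
  preimages (q ∷ qs) =
    let (x , p , e) = surjective q ; (xs , ps , es) = preimages qs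
    in x ∷ xs , p ∷ ps , cong₂ _∷_ e es
  found = preimages (All.tabulate λ {y} → to (g y))
  xs = proj₁ found
  all = proj₁ (proj₂ found)
  map≡ = proj₂ (proj₂ found)

-- Q need not be decidable: for elements of P, membership in the list that
-- enumerates the intersection decides it.
cardinality-difference : {A : Set} {P Q : A → Set} → DecidableEquality A →
                         HasCardinality P N → HasCardinality (λ x → P x × Q x) M →
                         ∃[ K ] (HasCardinality (λ x → P x × ¬ Q x) K × K + M ≡ N)
cardinality-difference {P = P} {Q = Q} _≟ᴬ_ hP@(xs , u , h , refl) hPQ@(ys , v , g , refl) =
  length zs , hP¬Q , cardinality-unique (cardinality-resp split
                      (cardinality-⊎ (λ { _ (_ , ¬q) (_ , q) → ¬q q }) hP¬Q hPQ)) hP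
  where
  zs = filter (λ x → ¬? (_∈?_ _≟ᴬ_ x ys)) xs
  hP¬Q : HasCardinality (λ x → P x × ¬ Q x) (length zs)
  hP¬Q =
    zs
    , Unique.filter⁺ _ u
    , (λ x → mk⇔
        (λ x∈ → let (x∈xs , x∉ys) = ∈-filter⁻ _ x∈ ; p = to (h x) x∈xs
                in p , λ q → x∉ys (from (g x) (p , q)))
        (λ (p , ¬q) → ∈-filter⁺ _ (from (h x) p) (λ x∈ys → ¬q (proj₂ (to (g x) x∈ys)))))
    , refl
  split : ∀ x → ((P x × ¬ Q x) ⊎ (P x × Q x)) ⇔ P x
  split x = mk⇔ [ proj₁ , proj₁ ]′ decide
    where
    decide : P x → (P x × ¬ Q x) ⊎ (P x × Q x)
    decide p with _∈?_ _≟ᴬ_ x ys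
    ... | yes x∈ys = inj₂ (to (g x) x∈ys)
    ... | no  x∉ys = inj₁ (p , λ q → x∉ys (from (g x) (p , q)))

-- Subdiagonal sequences with decreasing non-diagonal entries

-- The sequence is subdiagonal, and its non-diagonal entries are less
-- than m and strictly decreasing.  The entry a of a ∷ s is diagonal when
-- it equals the length of s; otherwise a takes the role of m in s.
data Staggered (m : ℕ) : List ℕ → Set where
  []      : Staggered m []
  diag    : ∀ {a s} → a ≡ length s → Staggered m s → Staggered m (a ∷ s)
  nondiag : ∀ {a s} → a < m → a < length s → Staggered a s → Staggered m (a ∷ s)

staggered-mono : ∀ {m n s} → m ≤ n → Staggered m s → Staggered n s
staggered-mono m≤n []                  = []
staggered-mono m≤n (diag e d)          = diag e (staggered-mono m≤n d)
staggered-mono m≤n (nondiag a<m a<l d) = nondiag (<-≤-trans a<m m≤n) a<l d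

staggered⇒subdiagonal : ∀ {m s} → Staggered m s → Subdiagonal s
staggered⇒subdiagonal (diag e _)        zero    = ≤-reflexive e
staggered⇒subdiagonal (diag _ d)        (suc j) = staggered⇒subdiagonal d j
staggered⇒subdiagonal (nondiag _ a<l _) zero    = <⇒≤ a<l
staggered⇒subdiagonal (nondiag _ _ d)   (suc j) = staggered⇒subdiagonal d j

staggered⇒bounded : ∀ {m s} → Staggered m s → ∀ j → ¬ Diagonal s j → lookup s j < m
staggered⇒bounded (diag e _)        zero    ¬d = contradiction e ¬d
staggered⇒bounded (diag _ d)        (suc j) ¬d = staggered⇒bounded d j ¬d
staggered⇒bounded (nondiag a<m _ _) zero    ¬d = a<m
staggered⇒bounded (nondiag a<m _ d) (suc j) ¬d = <-trans (staggered⇒bounded d j ¬d) a<m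

staggered⇒decreasing : ∀ {m s} → Staggered m s → NonDiagonalDecreasing s
staggered⇒decreasing (diag e _)      zero    _       _         ¬i _  = contradiction e ¬i
staggered⇒decreasing (nondiag _ _ d) zero    (suc j) _         _  ¬j = staggered⇒bounded d j ¬j
staggered⇒decreasing (diag _ d)      (suc i) (suc j) (s≤s i<j) ¬i ¬j =
  staggered⇒decreasing d i j i<j ¬i ¬j
staggered⇒decreasing (nondiag _ _ d) (suc i) (suc j) (s≤s i<j) ¬i ¬j =
  staggered⇒decreasing d i j i<j ¬i ¬j

decreasing⇒staggered : ∀ {m} s → Subdiagonal s → NonDiagonalDecreasing s →
                       (∀ j → ¬ Diagonal s j → lookup s j < m) → Staggered m s
decreasing⇒staggered []      sub dec bound = []
decreasing⇒staggered (a ∷ s) sub dec bound with a ≟ length s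
... | yes e = diag e (decreasing⇒staggered s (sub ∘ suc)
                       (λ i j i<j → dec (suc i) (suc j) (s≤s i<j)) (bound ∘ suc))
... | no ¬e = nondiag (bound zero ¬e) (≤∧≢⇒< (sub zero) ¬e)
                (decreasing⇒staggered s (sub ∘ suc)
                  (λ i j i<j → dec (suc i) (suc j) (s≤s i<j))
                  (λ j → dec zero (suc j) (s≤s z≤n) ¬e))

-- The entries of a subdiagonal sequence are less than its length, so that
-- with the length as bound m the condition on m is void.
staggered⇔decreasing : ∀ s → Staggered (length s) s ⇔ (Subdiagonal s × NonDiagonalDecreasing s)
staggered⇔decreasing s = mk⇔
  (λ d → staggered⇒subdiagonal d , staggered⇒decreasing d)
  (λ (sub , dec) → decreasing⇒staggered s sub dec (λ j _ → below s sub j))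
  where
  below : ∀ s → Subdiagonal s → ∀ j → lookup s j < length s
  below (_ ∷ _) sub j = s≤s (≤-trans (sub j) (m∸n≤m _ (toℕ j)))

-- Counting by length: the numbers c

-- The summation range of the recurrence: i ≤ n - 2 says that i is not
-- diagonal as first entry, and i ≤ m - 1 that i respects the bound m.
range : ∀ n m → from0To ((+ suc n ℤ.- + 2) ℤ.⊓ (+ m ℤ.- + 1)) ≡ upTo (n ⊓ m)
range zero    zero    = refl
range zero    (suc m) = refl
range (suc n) zero    = refl
range (suc n) (suc m) = refl

-- The set counted by c.  The sum is compared in the integers, because the
-- recurrence may pass to a negative k.
Counted : ℕ → ℕ → ℤ → List ℕ → Set
Counted n m k s = Staggered m s × length s ≡ n × + sum s ≡ k

sum-tail : ∀ a t {k} → + (a + t) ≡ k → + t ≡ k ℤ.- + a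
sum-tail a t refl = sym (trans (ℤ.m-n≡m⊖n (a + t) a)
  (trans (ℤ.⊖-≥ (m≤m+n a t)) (cong +_ (m+n∸m≡n a t))))

sum-cons : ∀ a t {k} → + t ≡ k ℤ.- + a → + (a + t) ≡ k
sum-cons a t {k} e = begin
  + (a + t)                ≡⟨ cong (ℤ._+_ (+ a)) e ⟩
  + a ℤ.+ (k ℤ.- + a)      ≡⟨ ℤ.+-comm (+ a) (k ℤ.- + a) ⟩
  (k ℤ.- + a) ℤ.+ + a      ≡⟨ ℤ.+-assoc k _ (+ a) ⟩
  k ℤ.+ (ℤ.- + a ℤ.+ + a)  ≡⟨ cong (ℤ._+_ k) (ℤ.+-inverseˡ (+ a)) ⟩
  k ℤ.+ + 0                ≡⟨ ℤ.+-identityʳ k ⟩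
  k                        ∎
  where open ≡-Reasoning

diagonal-remainder : ∀ k n → k ℤ.- + suc n ℤ.+ + 1 ≡ k ℤ.- + n
diagonal-remainder k n = trans (ℤ.+-assoc k _ (+ 1)) (cong (ℤ._+_ k) (lemma n))
  where
  lemma : ∀ n → -[1+ n ] ℤ.+ + 1 ≡ ℤ.- + n
  lemma zero    = refl
  lemma (suc n) = refl

-- The summands of the recurrence count the sequences with diagonal first
-- entry n and those with non-diagonal first entry i.
cardinality-c : ∀ n m k → HasCardinality (Counted n m k) (c (+ n) (+ m) k)
cardinality-c n m -[1+ k ] = cardinality-empty λ { _ (_ , _ , ()) }
cardinality-c zero m (+ zero) = cardinality-resp
  (λ s → mk⇔ (λ { refl → [] , refl , refl })
             (λ { ([] , _ , _) → refl ; (diag _ _ , () , _) ; (nondiag _ _ _ , () , _) }))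
  (cardinality-singleton [])
cardinality-c zero m (+ suc k) =
  cardinality-empty λ { _ ([] , _ , ()) ; _ (diag _ _ , () , _) ; _ (nondiag _ _ _ , () , _) }
cardinality-c (suc n) m (+ k) = cardinality-resp (λ s → mk⇔ cons uncons)
  (cardinality-⊎ head-distinct
    (cardinality-image (n ∷_) ∷-injectiveʳ (cardinality-c n m _))
    (cardinality-Σ (subst Unique (sym (range n m)) (Unique.upTo⁺ (n ⊓ m)))
      (λ { i j _ (_ , _ , e) (_ , _ , refl) → ∷-injectiveˡ e })
      (λ i → cardinality-image (i ∷_) ∷-injectiveʳ (cardinality-c n i _))))
  where
  indices = from0To ((+ suc n ℤ.- + 2) ℤ.⊓ (+ m ℤ.- + 1))

  DiagonalHead NonDiagonalHead : List ℕ → Set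
  DiagonalHead s = ∃[ t ] (Counted n m (+ k ℤ.- + suc n ℤ.+ + 1) t × n ∷ t ≡ s)
  NonDiagonalHead s =
    ∃[ i ] (i ∈ indices × ∃[ t ] (Counted n i (+ k ℤ.- + i) t × i ∷ t ≡ s))

  index-bound : ∀ {i} → i ∈ indices → i < n ⊓ m
  index-bound i∈ = ∈-upTo⁻ (subst (_ ∈_) (range n m) i∈)

  head-distinct : ∀ s → DiagonalHead s → ¬ NonDiagonalHead s
  head-distinct _ (_ , _ , refl) (_ , i∈ , _ , _ , refl) =
    <-irrefl refl (m<n⊓o⇒m<n n m (index-bound i∈))

  cons : ∀ {s} → DiagonalHead s ⊎ NonDiagonalHead s → Counted (suc n) m (+ k) s
  cons (inj₁ (t , (d , refl , e) , refl)) =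
    diag refl d , refl , sum-cons n (sum t) (trans e (diagonal-remainder (+ k) n))
  cons (inj₂ (i , i∈ , t , (d , refl , e) , refl)) =
    nondiag (m<n⊓o⇒m<o n m (index-bound i∈)) (m<n⊓o⇒m<n n m (index-bound i∈)) d
    , refl , sum-cons i (sum t) e

  uncons : ∀ {s} → Counted (suc n) m (+ k) s → DiagonalHead s ⊎ NonDiagonalHead s
  uncons (diag {a} {t} refl d , refl , e) = inj₁
    (t , (d , refl , trans (sum-tail n (sum t) e) (sym (diagonal-remainder (+ k) n))) , refl)
  uncons (nondiag {a} {t} a<m a<n d , refl , e) = inj₂
    (a , subst (a ∈_) (sym (range n m)) (∈-upTo⁺ (⊓-pres-m< a<n a<m))
       , t , (d , refl , sum-tail a (sum t) e) , refl)

-- The length is bounded in terms of the sum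

staggered-zero⇒staircase : ∀ {s} → Staggered 0 s → s ≡ downFrom (length s)
staggered-zero⇒staircase []         = refl
staggered-zero⇒staircase (diag e d) = cong₂ _∷_ e (staggered-zero⇒staircase d)

staircase-length≤sum+1 : ∀ {s} → Staggered 0 s → length s ≤ sum s + 1
staircase-length≤sum+1 [] = z≤n
staircase-length≤sum+1 (diag {s = s} refl d) =
  subst (_≤ length s + sum s + 1) (+-comm (length s) 1)
  (+-monoˡ-≤ 1 (m≤m+n (length s) (sum s)))

-- Apart from the last entry, a diagonal 0, at most one entry vanishes:
-- behind a non-diagonal 0 all entries are diagonal.
length≤sum+2 : ∀ {m s} → Staggered m s → length s ≤ sum s + 2
length≤sum+2 [] = z≤n
length≤sum+2 (diag {s = s} refl d) = ≤-trans (≤-reflexive (+-comm 1 (length s)))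
  (+-mono-≤ (m≤m+n (length s) (sum s)) (s≤s z≤n))
length≤sum+2 (nondiag {zero} {s} _ _ d) =
  subst (suc (length s) ≤_) (sym (+-suc (sum s) 1)) (s≤s (staircase-length≤sum+1 d))
length≤sum+2 (nondiag {suc a} {s} _ _ d) =
  s≤s (≤-trans (length≤sum+2 d) (+-monoˡ-≤ 2 (m≤n+m (sum s) a)))

-- The staircases of sum at least 2 are those of length at least 3.
staircase-length≤sum : ∀ {s} → Staggered 0 s → 2 ≤ sum s → length s ≤ sum s
staircase-length≤sum (diag {s = []} refl d) ()
staircase-length≤sum (diag {s = zero ∷ []} refl d) (s≤s ())
staircase-length≤sum (diag {s = suc a ∷ s} refl d) _ =
  ≤-trans (≤-reflexive (+-comm 1 _)) (+-monoʳ-≤ (suc (length s)) (s≤s z≤n))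
staircase-length≤sum (diag {s = zero ∷ b ∷ s} refl (diag () d))

-- Length sum + 2 requires two entries 0 and all others 1.  As at most one
-- entry 1 is diagonal and at most one is not, the sum is then at most 2.
3≤sum⇒length≤sum+1 : ∀ {m s} → Staggered m s → 3 ≤ sum s → length s ≤ sum s + 1
3≤sum⇒length≤sum+1 [] _ = z≤n
3≤sum⇒length≤sum+1 (diag {s = s} refl d) _ =
  subst (_≤ length s + sum s + 1) (+-comm (length s) 1)
  (+-monoˡ-≤ 1 (m≤m+n (length s) (sum s)))
3≤sum⇒length≤sum+1 (nondiag {zero} {s} _ _ d) 3≤ =
  subst (suc (length s) ≤_) (+-comm 1 (sum s)) (s≤s (staircase-length≤sum d (<⇒≤ 3≤)))
3≤sum⇒length≤sum+1 (nondiag {1} _ _ []) _ = s≤s z≤n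
3≤sum⇒length≤sum+1 (nondiag {1} _ _ (diag {s = s} refl d)) _ =
  s≤s (subst (_≤ length s + sum s + 1) (+-comm (length s) 1)
        (+-monoˡ-≤ 1 (m≤m+n (length s) (sum s))))
3≤sum⇒length≤sum+1 (nondiag {1} _ _ (nondiag {zero} {s} _ _ d)) (s≤s 2≤) =
  s≤s (subst (suc (length s) ≤_) (+-comm 1 (sum s)) (s≤s (staircase-length≤sum d 2≤)))
3≤sum⇒length≤sum+1 (nondiag {1} _ _ (nondiag {suc _} (s≤s ()) _ _)) _
3≤sum⇒length≤sum+1 (nondiag {suc (suc a)} {s} _ _ d) _ =
  s≤s (≤-trans (length≤sum+2 d) (subst (_≤ suc (a + sum s + 1)) (sym (+-suc (sum s) 1))
    (s≤s (+-monoˡ-≤ 1 (m≤n+m (sum s) a)))))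

-- The subdiagonal sequences of sum k with decreasing non-diagonal entries,
-- which are the codes of the 123-avoiding permutations with k inversions.
Code : ℕ → List ℕ → Set
Code k s = Staggered (length s) s × sum s ≡ k

cardinality-sumC : ∀ {u} k → (∀ {s} → Code k s → length s ≤ u) →
                   HasCardinality (Code k) (sumC u k)
cardinality-sumC {u} k bound = cardinality-resp
  (λ s → mk⇔ (λ { (_ , _ , d , refl , e) → d , ℤ.+-injective e })
             (λ (d , e) → length s , ∈-upTo⁺ (s≤s (bound (d , e))) , d , refl , cong +_ e))
  (cardinality-Σ (Unique.upTo⁺ (suc u))
    (λ { i j _ (_ , refl , _) (_ , refl , _) → refl })
    (λ n → cardinality-c n n (+ k)))

-- Decomposable sequences

staggered-downFrom : ∀ {m} n → Staggered m (downFrom n)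
staggered-downFrom zero    = []
staggered-downFrom (suc n) = diag (sym (length-downFrom n)) (staggered-downFrom n)

-- No entry of the first summand a ∷ ρ is diagonal in a ∷ ρ ++ τ, so that it
-- decreases strictly to its last entry 0, and τ has no non-diagonal entry.
-- Through a < m the entry preceding a is seen to exceed a.
decomposed : ∀ {m} a ρ τ → Subdiagonal (a ∷ ρ) → τ ≢ [] → Staggered m (a ∷ ρ ++ τ) →
             a < m × a ∷ ρ ≡ downFrom (suc (length ρ)) × Staggered 0 τ
decomposed a ρ [] sub τ≢[] d = contradiction refl τ≢[]
decomposed a ρ τ@(_ ∷ τ′) sub _ (diag e _) =
  contradiction (subst (_≤ length ρ) (trans e (length-++ ρ)) (sub zero))
    (<⇒≱ (m<m+n (length ρ) z<s))
decomposed zero [] τ sub τ≢[] (nondiag a<m _ d) = a<m , refl , d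
decomposed (suc a) [] τ sub τ≢[] d with () ← sub zero
decomposed a (b ∷ ρ) τ sub τ≢[] (nondiag a<m _ d)
  with (b<a , e , d′) ← decomposed b ρ τ (sub ∘ suc) τ≢[] d =
  a<m , cong₂ _∷_ (≤-antisym (sub zero) (subst (_< a) (∷-injectiveˡ e) b<a)) e , d′

-- The sequence p, p - 1, ..., 0 followed by q, q - 1, ..., 0.
staircases : ℕ × ℕ → List ℕ
staircases (p , q) = downFrom (suc p) ++ downFrom (suc q)

staircases-injective : ∀ {x y} → staircases x ≡ staircases y → x ≡ y
staircases-injective {p , q} {p′ , q′} e with refl ← ∷-injectiveˡ e =
  cong (p ,_) (∷-injectiveˡ (++-cancelˡ (downFrom (suc p)) _ _ e))

staggered-staircases : ∀ {m} p q → p ≤ m → Staggered m (downFrom p ++ downFrom (suc q))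
staggered-staircases zero    q p≤m = staggered-downFrom (suc q)
staggered-staircases (suc p) q p<m = nondiag p<m
  (subst (p <_) (sym (trans (length-++ (downFrom p)) (cong (_+ _) (length-downFrom p))))
    (m<m+n p z<s))
  (staggered-staircases p q ≤-refl)

decomposable⇔staircases : ∀ s → (Staggered (length s) s × DecomposableSeq s) ⇔
                                (∃[ x ] staircases x ≡ s)
decomposable⇔staircases s = mk⇔ ⇒ ⇐
  where
  ⇒ : ∀ {s} → Staggered (length s) s × DecomposableSeq s → ∃[ x ] staircases x ≡ s
  ⇒ (_ , [] , _ , _ , _ , ρ≢[] , _) = contradiction refl ρ≢[]
  ⇒ (_ , _ ∷ _ , [] , _ , _ , _ , τ≢[] , _) = contradiction refl τ≢[]
  ⇒ (d , a ∷ ρ , τ@(_ ∷ τ′) , sub , _ , _ , τ≢[] , refl)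
    with (_ , e , d′) ← decomposed a ρ τ sub τ≢[] d =
    (length ρ , length τ′) , cong₂ _++_ (sym e) (sym (staggered-zero⇒staircase d′))

  ⇐ : ∀ {s} → ∃[ x ] staircases x ≡ s → Staggered (length s) s × DecomposableSeq s
  ⇐ ((p , q) , refl) =
    staggered-staircases (suc p) q (≤-trans
      (≤-reflexive (sym (length-downFrom (suc p)))) (List.length-++-≤ˡ (downFrom (suc p))))
    , downFrom (suc p) , downFrom (suc q)
    , staggered⇒subdiagonal {0} (staggered-downFrom (suc p))
    , staggered⇒subdiagonal {0} (staggered-downFrom (suc q))
    , (λ ()) , (λ ()) , refl

-- The i-th triangular number, starting from 0 for i = 0.
triangular : ℕ → ℕ
triangular i = i * suc i / 2

sum-downFrom : ∀ i → sum (downFrom (suc i)) ≡ triangular i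
sum-downFrom i = sym (trans (cong (_/ 2) (sym (doubled i))) (m*n/n≡m _ 2))
  where
  step : ∀ i → suc i * 2 + i * suc i ≡ suc i * suc (suc i)
  step = solve-∀
  doubled : ∀ i → sum (downFrom (suc i)) * 2 ≡ i * suc i
  doubled zero    = refl
  doubled (suc i) = trans (*-distribʳ-+ 2 (suc i) (sum (downFrom (suc i))))
    (trans (cong (_+_ (suc i * 2)) (doubled i)) (step i))

i≤triangular : ∀ i → i ≤ triangular i
i≤triangular i = subst (i ≤_) (sum-downFrom i) (m≤m+n i _)

cardinality-triangular : ∀ j → HasCardinality (λ i → triangular i ≡ j) (triangularSeries j)
cardinality-triangular j =
  filter (λ i → triangular i ≟ j) (upTo (suc j))
  , Unique.filter⁺ (λ i → triangular i ≟ j) (Unique.upTo⁺ (suc j))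
  , (λ i → mk⇔
      (proj₂ ∘ ∈-filter⁻ (λ i → triangular i ≟ j) {xs = upTo (suc j)})
      (λ e → ∈-filter⁺ (λ i → triangular i ≟ j)
               (∈-upTo⁺ (s≤s (subst (i ≤_) e (i≤triangular i)))) e))
  , refl

cardinality-decomposable :
  ∀ k → HasCardinality (λ s → Code k s × DecomposableSeq s)
                       ((triangularSeries ⊛ triangularSeries) k)
cardinality-decomposable k = cardinality-resp (λ s → mk⇔ ⇒ ⇐)
  (cardinality-Σ (Unique.upTo⁺ (suc k))
    (λ { i j _ (_ , (refl , _) , refl) (_ , (refl , _) , e) →
           cong (triangular ∘ proj₁) (sym (staircases-injective e)) })
    (λ a → cardinality-image staircases staircases-injective
             (cardinality-× (cardinality-triangular a) (cardinality-triangular (k ∸ a)))))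
  where
  Staircases : List ℕ → Set
  Staircases s = ∃[ a ] (a ∈ upTo (suc k) ×
    ∃[ x ] ((triangular (proj₁ x) ≡ a × triangular (proj₂ x) ≡ k ∸ a) × staircases x ≡ s))

  sum-staircases : ∀ p q → sum (staircases (p , q)) ≡ triangular p + triangular q
  sum-staircases p q = trans (sum-++ (downFrom (suc p)) _)
    (cong₂ _+_ (sum-downFrom p) (sum-downFrom q))

  ⇒ : ∀ {s} → Staircases s → Code k s × DecomposableSeq s
  ⇒ (_ , a∈ , (p , q) , (refl , e) , refl) with from (decomposable⇔staircases _) ((p , q) , refl)
  ... | d , dec = (d , trans (sum-staircases p q)
    (trans (cong (_+_ (triangular p)) e) (m+[n∸m]≡n (≤-pred (∈-upTo⁻ a∈))))) , dec

  ⇐ : ∀ {s} → Code k s × DecomposableSeq s → Staircases s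
  ⇐ ((d , refl) , dec) with to (decomposable⇔staircases _) (d , dec)
  ... | (p , q) , refl rewrite sum-staircases p q =
    triangular p , ∈-upTo⁺ (s≤s (m≤m+n _ _)) , (p , q) ,
    (refl , sym (m+n∸m≡n (triangular p) _)) , refl

-- The code of a word

-- The number of letters of ys that are smaller than x.
smaller : ℕ → List ℕ → ℕ
smaller x ys = length (filter (_<? x) ys)

-- The Lehmer code: each letter is replaced by the number of smaller
-- letters to its right.
code : List ℕ → List ℕ
code []       = []
code (x ∷ xs) = smaller x xs ∷ code xs

length-code : ∀ xs → length (code xs) ≡ length xs
length-code []       = refl
length-code (x ∷ xs) = cong suc (length-code xs)

smaller-accept : ∀ {x y} ys → y < x → smaller x (y ∷ ys) ≡ suc (smaller x ys)
smaller-accept ys y<x = cong length (filter-accept (_<? _) {xs = ys} y<x)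

smaller-reject : ∀ {x y} ys → ¬ y < x → smaller x (y ∷ ys) ≡ smaller x ys
smaller-reject ys y≮x = cong length (filter-reject (_<? _) {xs = ys} y≮x)

smaller≤length : ∀ x ys → smaller x ys ≤ length (code ys)
smaller≤length x ys = ≤-trans (length-filter (_<? x) ys) (≤-reflexive (sym (length-code ys)))

smaller≡length⇒all : ∀ x ys → smaller x ys ≡ length (code ys) → All (_< x) ys
smaller≡length⇒all x ys e = subst (All (_< x))
  (filter-complete (_<? x) (trans e (length-code ys))) (All.all-filter (_<? x) ys)

all⇒smaller≡length : ∀ x ys → All (_< x) ys → smaller x ys ≡ length (code ys)
all⇒smaller≡length x ys all =
  trans (cong length (filter-all (_<? x) all)) (sym (length-code ys))

smaller-∷ : ∀ x y ys → smaller x ys ≤ smaller x (y ∷ ys)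
smaller-∷ x y ys with y <? x
... | yes y<x = ≤-trans (n≤1+n _) (≤-reflexive (sym (smaller-accept ys y<x)))
... | no  y≮x = ≤-reflexive (sym (smaller-reject ys y≮x))

smaller-mono : ∀ {x y} → x ≤ y → ∀ zs → smaller x zs ≤ smaller y zs
smaller-mono x≤y [] = z≤n
smaller-mono {x} {y} x≤y (z ∷ zs) with z <? x
... | yes z<x = begin
  smaller x (z ∷ zs)  ≡⟨ smaller-accept zs z<x ⟩
  suc (smaller x zs)  ≤⟨ s≤s (smaller-mono x≤y zs) ⟩
  suc (smaller y zs)  ≡⟨ smaller-accept zs (<-≤-trans z<x x≤y) ⟨
  smaller y (z ∷ zs)  ∎
  where open ≤-Reasoning
... | no z≮x = begin
  smaller x (z ∷ zs)  ≡⟨ smaller-reject zs z≮x ⟩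
  smaller x zs        ≤⟨ smaller-mono x≤y zs ⟩
  smaller y zs        ≤⟨ smaller-∷ y z zs ⟩
  smaller y (z ∷ zs)  ∎
  where open ≤-Reasoning

smaller-↭ : ∀ x {ys zs} → ys ↭ zs → smaller x ys ≡ smaller x zs
smaller-↭ x = ↭-length ∘ filter-↭ (_<? x)

length-filter-map : {P : Pred B 0ℓ} (P? : Decidable P) (f : A → B) (xs : List A) →
                    length (filter P? (map f xs)) ≡ length (filter (P? ∘ f) xs)
length-filter-map P? f [] = refl
length-filter-map P? f (x ∷ xs) with P? (f x)
... | yes _ = cong suc (length-filter-map P? f xs)
... | no  _ = length-filter-map P? f xs

-- Inversions

length-filter-cartesianProduct :
  {P : Pred (A × B) 0ℓ} (P? : Decidable P) (xs : List A) (ys : List B) →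
  length (filter P? (cartesianProduct xs ys)) ≡
  sum (map (λ x → length (filter (λ y → P? (x , y)) ys)) xs)
length-filter-cartesianProduct P? [] ys = refl
length-filter-cartesianProduct P? (x ∷ xs) ys = begin
  length (filter P? (map (x ,_) ys ++ cartesianProduct xs ys))
    ≡⟨ cong length (filter-++ P? (map (x ,_) ys) _) ⟩
  length (filter P? (map (x ,_) ys) ++ filter P? (cartesianProduct xs ys))
    ≡⟨ length-++ (filter P? (map (x ,_) ys)) ⟩
  length (filter P? (map (x ,_) ys)) + length (filter P? (cartesianProduct xs ys))
    ≡⟨ cong₂ _+_ (length-filter-map P? (x ,_) ys) (length-filter-cartesianProduct P? xs ys) ⟩
  length (filter (λ y → P? (x , y)) ys) +
  sum (map (λ x → length (filter (λ y → P? (x , y)) ys)) xs) ∎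
  where open ≡-Reasoning

-- The number of inversions whose left end is at position i.
inversionsAt : ∀ xs → Fin (length xs) → ℕ
inversionsAt xs i =
  length (filter (λ j → (i Fin.<? j) ×-dec (lookup xs j <? lookup xs i)) (allFin (length xs)))

allFin-suc : ∀ n → allFin (suc n) ≡ zero ∷ map suc (allFin n)
allFin-suc n = cong (zero ∷_) (sym (map-tabulate id suc))

inversionsAt-zero : ∀ x xs → inversionsAt (x ∷ xs) zero ≡ smaller x xs
inversionsAt-zero x xs = begin
  inversionsAt (x ∷ xs) zero
    ≡⟨ cong (length ∘ filter P?) (allFin-suc (length xs)) ⟩
  length (filter P? (map suc (allFin (length xs))))
    ≡⟨ length-filter-map P? suc (allFin (length xs)) ⟩
  length (filter (P? ∘ suc) (allFin (length xs)))
    ≡⟨ cong length (filter-≐ (P? ∘ suc) (λ j → lookup xs j <? x)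
         ((λ (_ , q) → q) , (λ q → z<s , q)) (allFin (length xs))) ⟩
  length (filter (λ j → lookup xs j <? x) (allFin (length xs)))
    ≡⟨ length-filter-map (_<? x) (lookup xs) (allFin (length xs)) ⟨
  smaller x (map (lookup xs) (allFin (length xs)))
    ≡⟨ cong (smaller x) (trans (map-tabulate id (lookup xs)) (tabulate-lookup xs)) ⟩
  smaller x xs ∎
  where
  open ≡-Reasoning
  P? : Decidable (λ (j : Fin (suc (length xs))) → 0 < toℕ j × lookup (x ∷ xs) j < x)
  P? j = (zero {length xs} Fin.<? j) ×-dec (lookup (x ∷ xs) j <? x)

inversionsAt-suc : ∀ x xs i → inversionsAt (x ∷ xs) (suc i) ≡ inversionsAt xs i
inversionsAt-suc x xs i = begin
  inversionsAt (x ∷ xs) (suc i)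
    ≡⟨ cong (length ∘ filter P?) (allFin-suc (length xs)) ⟩
  length (filter P? (map suc (allFin (length xs))))
    ≡⟨ length-filter-map P? suc (allFin (length xs)) ⟩
  length (filter (P? ∘ suc) (allFin (length xs)))
    ≡⟨ cong length (filter-≐ (P? ∘ suc) (λ j → (i Fin.<? j) ×-dec (lookup xs j <? lookup xs i))
         ((λ (p , q) → s<s⁻¹ p , q) , (λ (p , q) → s<s p , q)) (allFin (length xs))) ⟩
  inversionsAt xs i ∎
  where
  open ≡-Reasoning
  P? : Decidable (λ (j : Fin (suc (length xs))) → suc i Fin.< j × lookup (x ∷ xs) j < lookup xs i)
  P? j = (suc i Fin.<? j) ×-dec (lookup (x ∷ xs) j <? lookup xs i)

inversions-sum : ∀ xs → inversions xs ≡ sum (map (inversionsAt xs) (allFin (length xs)))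
inversions-sum xs = length-filter-cartesianProduct
  (λ (i , j) → (i Fin.<? j) ×-dec (lookup xs j <? lookup xs i))
  (allFin (length xs)) (allFin (length xs))

sum-code : ∀ xs → sum (code xs) ≡ inversions xs
sum-code [] = refl
sum-code (x ∷ xs) = sym (begin
  inversions (x ∷ xs)
    ≡⟨ inversions-sum (x ∷ xs) ⟩
  sum (map (inversionsAt (x ∷ xs)) (allFin (suc (length xs))))
    ≡⟨ cong (sum ∘ map (inversionsAt (x ∷ xs))) (allFin-suc (length xs)) ⟩
  inversionsAt (x ∷ xs) zero + sum (map (inversionsAt (x ∷ xs)) (map suc (allFin (length xs))))
    ≡⟨ cong₂ _+_ (inversionsAt-zero x xs)
         (cong sum (trans (sym (map-∘ (allFin (length xs))))
           (map-cong (inversionsAt-suc x xs) (allFin (length xs))))) ⟩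
  smaller x xs + sum (map (inversionsAt xs) (allFin (length xs)))
    ≡⟨ cong (_+_ (smaller x xs)) (inversions-sum xs) ⟨
  smaller x xs + inversions xs
    ≡⟨ cong (_+_ (smaller x xs)) (sum-code xs) ⟨
  smaller x xs + sum (code xs) ∎)
  where open ≡-Reasoning

-- The code determines the permutation, and is any subdiagonal sequence

-- If x < y, then x itself is counted by smaller y (x ∷ xs), and this
-- number does not depend on the order of the letters.
head-not-less : ∀ {x y xs ys} → x ∷ xs ↭ y ∷ ys → smaller x xs ≡ smaller y ys → ¬ x < y
head-not-less {x} {y} {xs} {ys} p e x<y = <-irrefl e (begin-strict
  smaller x xs        ≤⟨ smaller-mono (<⇒≤ x<y) xs ⟩
  smaller y xs        <⟨ n<1+n _ ⟩
  suc (smaller y xs)  ≡⟨ smaller-accept xs x<y ⟨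
  smaller y (x ∷ xs)  ≡⟨ smaller-↭ y p ⟩
  smaller y (y ∷ ys)  ≡⟨ smaller-reject ys (<-irrefl refl) ⟩
  smaller y ys        ∎)
  where open ≤-Reasoning

-- For arbitrary words on the same multiset of letters.
code-injective : ∀ {xs ys} → xs ↭ ys → code xs ≡ code ys → xs ≡ ys
code-injective {[]}     {[]}     p e = refl
code-injective {x ∷ xs} {y ∷ ys} p e
  with refl ← ≤-antisym (≮⇒≥ (head-not-less (↭-sym p) (sym (∷-injectiveˡ e))))
                        (≮⇒≥ (head-not-less p (∷-injectiveˡ e))) =
  cong (x ∷_) (code-injective (drop-∷ p) (∷-injectiveʳ e))

-- Removing the entry at position a of an increasing list.
extract : ∀ {l} a → AllPairs _<_ l → a < length l →
          ∃[ x ] ∃[ l′ ] (l ↭ x ∷ l′ × AllPairs _<_ l′ × smaller x l′ ≡ a)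
extract {y ∷ l} zero (y< ∷ inc) _ =
  y , l , ↭-refl , inc , cong length (filter-none (_<? y) (All.map <⇒≯ y<))
extract {y ∷ l} (suc a) (y< ∷ inc) (s≤s a<) with extract a inc a<
... | x , l′ , p , inc′ , e with y<x ∷ y<′ ← All-resp-↭ p y< =
  x , y ∷ l′ , ↭-trans (prep y p) (swap y x ↭-refl) , y<′ ∷ inc′ ,
  trans (smaller-accept l′ y<x) (cong suc e)

-- Every subdiagonal sequence is the code of a word on any alphabet l of the
-- right size: an entry gives the rank of its letter among the letters of l
-- that are not yet used.
decode : ∀ {l} s → AllPairs _<_ l → length l ≡ length s → Subdiagonal s →
         ∃[ xs ] (xs ↭ l × code xs ≡ s)
decode {[]} [] inc e sub = [] , ↭-refl , refl
decode (a ∷ s) inc e sub with extract a inc (subst (a <_) (sym e) (s≤s (sub zero)))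
... | x , l′ , p , inc′ , ea
  with decode s inc′ (suc-injective (trans (sym (↭-length p)) e)) (sub ∘ suc)
... | xs , q , es =
  x ∷ xs , ↭-trans (prep x q) (↭-sym p) , cong₂ _∷_ (trans (smaller-↭ x q) ea) es

identity-increasing : ∀ n → AllPairs _<_ (applyUpTo suc n)
identity-increasing n = AllPairs.applyUpTo⁺₁ suc n (λ i<j _ → s<s i<j)

code-surjective : ∀ s → Subdiagonal s → ∃[ π ] (IsPermutation π × code π ≡ s)
code-surjective s sub
  with π , p , e ← decode s (identity-increasing (length s)) (length-applyUpTo suc (length s)) sub =
  π , subst (λ n → π ↭ applyUpTo suc n) (trans (cong length (sym e)) (length-code π)) p , e

code-injective-permutation : ∀ {π σ} → IsPermutation π → IsPermutation σ →
                             code π ≡ code σ → π ≡ σ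
code-injective-permutation {π} {σ} p q e = code-injective (↭-trans p (↭-trans
  (↭-reflexive (cong (applyUpTo suc)
    (trans (sym (length-code π)) (trans (cong length e) (length-code σ)))))
  (↭-sym q))) e

permutation-bound : ∀ {π} → IsPermutation π → All (_≤ length π) π
permutation-bound {π} p =
  All-resp-↭ (↭-sym p) (All.applyUpTo⁺₁ suc (length π) id)

permutation-unique : ∀ {π} → IsPermutation π → Unique π
permutation-unique {π} p = Permutationₛ.Unique-resp-↭ (setoid ℕ) (↭⇒↭ₛ (↭-sym p))
  (AllPairs.map <⇒≢ (identity-increasing (length π)))

-- Sums

smaller-shift : ∀ n x ys → smaller (n + x) (map (λ t → n + t) ys) ≡ smaller x ys
smaller-shift n x ys = trans (length-filter-map (_<? n + x) (λ t → n + t) ys)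
  (cong length (filter-≐ ((_<? n + x) ∘ (λ t → n + t)) (_<? x)
    ((λ {y} → +-cancelˡ-< n y x) , +-monoʳ-< n) ys))

code-shift : ∀ n xs → code (map (λ t → n + t) xs) ≡ code xs
code-shift n []       = refl
code-shift n (x ∷ xs) = cong₂ _∷_ (smaller-shift n x xs) (code-shift n xs)

code-++ : ∀ xs {ys} → All (λ x → All (x ≤_) ys) xs → code (xs ++ ys) ≡ code xs ++ code ys
code-++ [] [] = refl
code-++ (x ∷ xs) {ys} (x≤ ∷ xs≤) = cong₂ _∷_ smaller-++ (code-++ xs xs≤)
  where
  open ≡-Reasoning
  smaller-++ : smaller x (xs ++ ys) ≡ smaller x xs
  smaller-++ = begin
    smaller x (xs ++ ys)
      ≡⟨ cong length (filter-++ (_<? x) xs ys) ⟩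
    length (filter (_<? x) xs ++ filter (_<? x) ys)
      ≡⟨ cong (λ l → length (filter (_<? x) xs ++ l)) (filter-none (_<? x) (All.map ≤⇒≯ x≤)) ⟩
    length (filter (_<? x) xs ++ [])
      ≡⟨ cong length (List.++-identityʳ (filter (_<? x) xs)) ⟩
    smaller x xs ∎

code-⊕ : ∀ {ρ τ} → IsPermutation ρ → code (ρ ⊕ τ) ≡ code ρ ++ code τ
code-⊕ {ρ} {τ} p = trans
  (code-++ ρ (All.map (λ x≤n → All.map⁺ (All.universal (λ t → m≤n⇒m≤n+o t x≤n) τ))
                      (permutation-bound p)))
  (cong (code ρ ++_) (code-shift (length ρ) τ))

applyUpTo-+ : ∀ (f : ℕ → ℕ) m n →
              applyUpTo f (m + n) ≡ applyUpTo f m ++ applyUpTo (λ i → f (m + i)) n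
applyUpTo-+ f zero    n = refl
applyUpTo-+ f (suc m) n = cong (f 0 ∷_) (applyUpTo-+ (f ∘ suc) m n)

⊕-permutation : ∀ {ρ τ} → IsPermutation ρ → IsPermutation τ → IsPermutation (ρ ⊕ τ)
⊕-permutation {ρ} {τ} p q = ↭-trans (++⁺ p (map⁺ (λ t → length ρ + t) q)) (↭-reflexive (sym (begin
  applyUpTo suc (length (ρ ⊕ τ))
    ≡⟨ cong (applyUpTo suc) (trans (length-++ ρ) (cong (_+_ (length ρ)) (length-map _ τ))) ⟩
  applyUpTo suc (length ρ + length τ)
    ≡⟨ applyUpTo-+ suc (length ρ) (length τ) ⟩
  applyUpTo suc (length ρ) ++ applyUpTo (λ i → suc (length ρ + i)) (length τ)
    ≡⟨ cong (applyUpTo suc (length ρ) ++_) (shifted (length τ)) ⟩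
  applyUpTo suc (length ρ) ++ map (λ t → length ρ + t) (applyUpTo suc (length τ)) ∎)))
  where
  open ≡-Reasoning
  shifted : ∀ n → applyUpTo (λ i → suc (length ρ + i)) n ≡
                  map (λ t → length ρ + t) (applyUpTo suc n)
  shifted n = trans (sym (map-applyUpTo (λ i → i) (λ i → suc (length ρ + i)) n))
    (trans (map-cong (λ i → sym (+-suc (length ρ) i)) _)
      (trans (map-applyUpTo (λ i → i) (λ i → length ρ + suc i) n)
        (sym (map-applyUpTo suc (λ t → length ρ + t) n))))

code-subdiagonal : ∀ π → Subdiagonal (code π)
code-subdiagonal (x ∷ xs) zero    = smaller≤length x xs
code-subdiagonal (x ∷ xs) (suc j) = code-subdiagonal xs j

code≢[] : ∀ {π} → π ≢ [] → code π ≢ []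
code≢[] {[]}    π≢[] = λ _ → π≢[] refl
code≢[] {_ ∷ _} π≢[] = λ ()

decomposable⇔ : ∀ {π} → IsPermutation π → Decomposable π ⇔ DecomposableSeq (code π)
decomposable⇔ {π} p = mk⇔
  (λ { (ρ , τ , pρ , pτ , ρ≢[] , τ≢[] , refl) →
         code ρ , code τ , code-subdiagonal ρ , code-subdiagonal τ ,
         code≢[] ρ≢[] , code≢[] τ≢[] , code-⊕ pρ })
  ⇐
  where
  ⇐ : DecomposableSeq (code π) → Decomposable π
  ⇐ (s , t , sub-s , sub-t , s≢[] , t≢[] , e)
    with code-surjective s sub-s | code-surjective t sub-t
  ... | ρ , pρ , refl | τ , pτ , refl =
    ρ , τ , pρ , pτ , (λ { refl → s≢[] refl }) , (λ { refl → t≢[] refl }) ,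
    code-injective-permutation p (⊕-permutation pρ pτ) (trans e (sym (code-⊕ pρ)))

-- Avoiding 123

-- Whenever a letter y precedes a letter z, not necessarily adjacently, and
-- y < z, then y ≤ x.  In other words, x does not start a pattern 123 when
-- put in front of the word.
NoAscentAbove : ℕ → List ℕ → Set
NoAscentAbove x = AllPairs (λ y z → x < y → z ≤ y)

-- Avoidance of 123, by recursion on the word.
Avoids123 : List ℕ → Set
Avoids123 []       = ⊤
Avoids123 (x ∷ xs) = NoAscentAbove x xs × Avoids123 xs

allPairs-lookup : ∀ {R : A → A → Set} {xs} → AllPairs R xs →
                  ∀ i j → i Fin.< j → R (lookup xs i) (lookup xs j)
allPairs-lookup (r ∷ rs) zero    (suc j) i<j = All.lookup r (∈-lookup j)
allPairs-lookup (r ∷ rs) (suc i) (suc j) i<j = allPairs-lookup rs i j (s<s⁻¹ i<j)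

allPairs-tabulate : ∀ {R : A → A → Set} xs →
                    (∀ i j → i Fin.< j → R (lookup xs i) (lookup xs j)) → AllPairs R xs
allPairs-tabulate {R = R} xs r = subst (AllPairs R) (tabulate-lookup xs)
  (AllPairs.tabulate⁺-< (λ {i} {j} → r i j))

allPairs-const : ∀ {P : A → Set} {R : A → A → Set} {xs} → (∀ {x y} → P x → R x y) →
                 All P xs → AllPairs R xs
allPairs-const f []       = []
allPairs-const f (p ∷ ps) = All.universal (λ _ → f p) _ ∷ allPairs-const f ps

-- Avoidance of 123, by positions: if the letters at i < j ascend, then no
-- letter after position j is larger than the one at j.
No123 : List ℕ → Set
No123 π = ∀ i j k → i Fin.< j → j Fin.< k → lookup π i < lookup π j → lookup π k ≤ lookup π j

no123⇒avoids123 : ∀ π → No123 π → Avoids123 π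
no123⇒avoids123 []       h = tt
no123⇒avoids123 (x ∷ xs) h =
  allPairs-tabulate xs (λ j k j<k → h zero (suc j) (suc k) z<s (s<s j<k)) ,
  no123⇒avoids123 xs (λ i j k i<j j<k → h (suc i) (suc j) (suc k) (s<s i<j) (s<s j<k))

avoids123⇒no123 : ∀ π → Avoids123 π → No123 π
avoids123⇒no123 (x ∷ xs) (h , _) zero    (suc j) (suc k) _   j<k =
  allPairs-lookup h j k (s<s⁻¹ j<k)
avoids123⇒no123 (x ∷ xs) (_ , a) (suc i) (suc j) (suc k) i<j j<k =
  avoids123⇒no123 xs a i j k (s<s⁻¹ i<j) (s<s⁻¹ j<k)

contains-p123 : ∀ π i j k → i Fin.< j → j Fin.< k →
                lookup π i < lookup π j → lookup π j < lookup π k → Contains π p123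
contains-p123 π i j k i<j j<k x<y y<z = f , increasing , isomorphic
  where
  f : Fin 3 → Fin (length π)
  f zero             = i
  f (suc zero)       = j
  f (suc (suc zero)) = k

  increasing : ∀ a b → a Fin.< b → f a Fin.< f b
  increasing zero       (suc zero)       _ = i<j
  increasing zero       (suc (suc zero)) _ = <-trans i<j j<k
  increasing (suc zero) (suc (suc zero)) _ = j<k
  increasing (suc zero)       (suc zero)       (s≤s ())
  increasing (suc (suc zero)) (suc zero)       (s≤s ())
  increasing (suc (suc zero)) (suc (suc zero)) (s≤s (s≤s ()))

  both : ∀ {m n o p} → m < n → o < p → (m < n) ⇔ (o < p)
  both m<n o<p = mk⇔ (const o<p) (const m<n)

  neither : ∀ {m n o p} → n ≤ m → p ≤ o → (m < n) ⇔ (o < p)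
  neither n≤m p≤o = mk⇔ (λ m<n → contradiction m<n (≤⇒≯ n≤m))
                        (λ o<p → contradiction o<p (≤⇒≯ p≤o))

  isomorphic : ∀ a b → lookup p123 a < lookup p123 b ⇔ lookup π (f a) < lookup π (f b)
  isomorphic zero             zero             = neither ≤-refl ≤-refl
  isomorphic zero             (suc zero)       = both ≤-refl x<y
  isomorphic zero             (suc (suc zero)) = both (s≤s (s≤s z≤n)) (<-trans x<y y<z)
  isomorphic (suc zero)       zero             = neither (s≤s z≤n) (<⇒≤ x<y)
  isomorphic (suc zero)       (suc zero)       = neither ≤-refl ≤-refl
  isomorphic (suc zero)       (suc (suc zero)) = both ≤-refl y<z
  isomorphic (suc (suc zero)) zero             = neither (s≤s z≤n) (<⇒≤ (<-trans x<y y<z))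
  isomorphic (suc (suc zero)) (suc zero)       = neither (s≤s (s≤s z≤n)) (<⇒≤ y<z)
  isomorphic (suc (suc zero)) (suc (suc zero)) = neither ≤-refl ≤-refl

avoids⇔avoids123 : ∀ π → Avoids π p123 ⇔ Avoids123 π
avoids⇔avoids123 π = mk⇔
  (λ avoids → no123⇒avoids123 π (λ i j k i<j j<k x<y →
    ≮⇒≥ (λ y<z → avoids (contains-p123 π i j k i<j j<k x<y y<z))))
  (λ a (f , increasing , isomorphic) →
    <⇒≱ (to (isomorphic (suc zero) (suc (suc zero))) ≤-refl)
      (avoids123⇒no123 π a (f zero) (f (suc zero)) (f (suc (suc zero)))
        (increasing zero (suc zero) ≤-refl)
        (increasing (suc zero) (suc (suc zero)) ≤-refl)
        (to (isomorphic zero (suc zero)) ≤-refl)))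

-- A first letter w > x cannot start an ascent: its entry would be
-- non-diagonal and at least the bound smaller x ws.  If w ≤ x, then the
-- claim follows from the avoidance of 123 by w ∷ ws.
noAscentAbove : ∀ x xs → Staggered (smaller x xs) (code xs) → Avoids123 xs → NoAscentAbove x xs
noAscentAbove x [] d a = []
noAscentAbove x (w ∷ ws) d (aw , aws) with x <? w
noAscentAbove x (w ∷ ws) (diag e d) (aw , aws) | yes x<w =
  All.map (λ z<w _ → <⇒≤ z<w) (smaller≡length⇒all w ws e) ∷
  noAscentAbove x ws (subst (λ n → Staggered n (code ws)) (smaller-reject ws (<⇒≯ x<w)) d) aws
noAscentAbove x (w ∷ ws) (nondiag l _ _) _ | yes x<w =
  contradiction (subst (smaller w ws <_) (smaller-reject ws (<⇒≯ x<w)) l)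
    (≤⇒≯ (smaller-mono (<⇒≤ x<w) ws))
noAscentAbove x (w ∷ ws) d (aw , aws) | no x≮w =
  All.universal (λ _ x<w → contradiction x<w x≮w) ws ∷
  AllPairs.map (λ f x<y → f (≤-<-trans (≮⇒≥ x≮w) x<y)) aw

staggered⇒avoids123 : ∀ {m} xs → Staggered m (code xs) → Avoids123 xs
staggered⇒avoids123 []       d = tt
staggered⇒avoids123 (x ∷ xs) (diag e d) =
  allPairs-const (λ y<x x<y → contradiction x<y (<⇒≯ y<x)) (smaller≡length⇒all x xs e) ,
  staggered⇒avoids123 xs d
staggered⇒avoids123 (x ∷ xs) (nondiag _ _ d) = noAscentAbove x xs d a , a
  where a = staggered⇒avoids123 xs d

-- A letter w with a non-diagonal entry starts an ascent, so that w < x.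
-- Then w and the smaller letters on its right all contribute to the entry
-- of x.
staggered-below : ∀ x xs → Unique (x ∷ xs) → NoAscentAbove x xs → Avoids123 xs →
                  Staggered (smaller x xs) (code xs)
staggered-below x [] _ _ _ = []
staggered-below x (w ∷ ws) ((x≢w ∷ x∉) ∷ (w∉ ∷ u)) (hw ∷ h) (aw , aws)
  with smaller w ws ≟ length (code ws)
... | yes e = diag e (staggered-mono (smaller-∷ x w ws) (staggered-below x ws (x∉ ∷ u) h aws))
... | no ne = nondiag
  (subst (smaller w ws <_) (sym (smaller-accept ws w<x)) (s≤s (smaller-mono (<⇒≤ w<x) ws)))
  (≤∧≢⇒< (smaller≤length w ws) ne)
  (staggered-below w ws (w∉ ∷ u) aw aws)
  where
  w<x : w < x
  w<x = ≤∧≢⇒< (≮⇒≥ (λ x<w → ne (all⇒smaller≡length w ws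
          (All.zipWith (λ (f , w≢z) → ≤∧≢⇒< (f x<w) (≢-sym w≢z)) (hw , w∉)))))
        (≢-sym x≢w)

avoids123⇒staggered : ∀ xs → Unique xs → Avoids123 xs → Staggered (length (code xs)) (code xs)
avoids123⇒staggered []       _ _ = []
avoids123⇒staggered (x ∷ xs) u (h , a) with smaller x xs ≟ length (code xs)
... | yes e = diag e (staggered-mono (n≤1+n _) (avoids123⇒staggered xs (AllPairs.tail u) a))
... | no ne = nondiag (s≤s (smaller≤length x xs)) (≤∧≢⇒< (smaller≤length x xs) ne)
                (staggered-below x xs u h a)

-- The enumeration

module _ (k : ℕ) where

  avoider⇒code : ∀ {π} → AvoidersWithInversions k p123 π → Code k (code π)
  avoider⇒code {π} (p , e , a) =
    avoids123⇒staggered π (permutation-unique p) (to (avoids⇔avoids123 π) a) ,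
    trans (sum-code π) e

  code⇒avoider : ∀ {s} → Code k s → ∃[ π ] (AvoidersWithInversions k p123 π × code π ≡ s)
  code⇒avoider {s} (d , e)
    with π , p , refl ← code-surjective s (staggered⇒subdiagonal d) =
    π , (p , trans (sym (sum-code π)) e
           , from (avoids⇔avoids123 π) (staggered⇒avoids123 π d)) , refl

  cardinality-avoiders : ∀ {N} → HasCardinality (Code k) N →
                         HasCardinality (AvoidersWithInversions k p123) N
  cardinality-avoiders = cardinality-bijection code avoider⇒code
    (λ (p , _) (q , _) → code-injective-permutation p q) code⇒avoider

  cardinality-indecomposables : ∀ {N} → HasCardinality (λ s → Code k s × IndecomposableSeq s) N →
                                HasCardinality (I k p123) N
  cardinality-indecomposables = cardinality-bijection code
    (λ (a@(p , _) , indec) → avoider⇒code a , indec ∘ from (decomposable⇔ p))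
    (λ ((p , _) , _) ((q , _) , _) → code-injective-permutation p q)
    surjective
    where
    surjective : ∀ {s} → Code k s × IndecomposableSeq s → ∃[ π ] (I k p123 π × code π ≡ s)
    surjective (c , indec) with π , a , refl ← code⇒avoider c =
      π , (a , indec ∘ to (decomposable⇔ (proj₁ a))) , refl

  cardinality-subdiagonal : ∀ {N} → HasCardinality (λ s → Code k s × IndecomposableSeq s) N →
                            HasCardinality (SubdiagonalSequences k) N
  cardinality-subdiagonal = cardinality-resp λ s → mk⇔
    (λ ((d , e) , indec) → let (sub , dec) = to (staggered⇔decreasing s) d
                           in sub , indec , e , dec)
    (λ (sub , indec , e , dec) → (from (staggered⇔decreasing s) (sub , dec) , e) , indec)

codes : ∀ k → HasCardinality (Code k) (sumC (k + 2) k)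
codes k = cardinality-sumC {k + 2} k (λ { (d , refl) → length≤sum+2 d })

codes-short : ∀ {k} → 3 ≤ k → HasCardinality (Code k) (sumC (k + 1) k)
codes-short {k} 3≤k = cardinality-sumC {k + 1} k (λ { (d , refl) → 3≤sum⇒length≤sum+1 d 3≤k })

+-subtract : ∀ {K M N} → K + M ≡ N → + K ≡ + N ℤ.- + M
+-subtract {K} {M} refl = sym (trans (ℤ.m-n≡m⊖n (K + M) M)
  (trans (ℤ.⊖-≥ (m≤n+m M K)) (cong +_ (m+n∸n≡m K M))))

theorem9 : (k : ℕ) →
    ∃[ N ] (HasCardinality (I k p123) N
    × HasCardinality (SubdiagonalSequences k) N
    × (HasCardinality (AvoidersWithInversions k p123) (sumC (k + 2) k)
    × + N ≡ + sumC (k + 2) k ℤ.- + (triangularSeries ⊛ triangularSeries) k)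
    × (3 ≤ k →
    HasCardinality (AvoidersWithInversions k p123) (sumC (k + 1) k)
    × + N ≡ + sumC (k + 1) k ℤ.- + (triangularSeries ⊛ triangularSeries) k))
theorem9 k
  with N , indecomposables , N+T≡ ←
    cardinality-difference (List.≡-dec _≟_) (codes k) (cardinality-decomposable k) =
  N , cardinality-indecomposables k indecomposables
    , cardinality-subdiagonal k indecomposables
    , (cardinality-avoiders k (codes k) , +-subtract N+T≡)
    , λ 3≤k →
        cardinality-avoiders k (codes-short 3≤k) ,
        +-subtract (trans N+T≡ (cardinality-unique (codes k) (codes-short 3≤k)))
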